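{- Let $K$ be a subfield of $\mathbb{C}$ and let $(A_1,\ldots,A_p)$ be a tuple of $p$ matrices of $M_n(K)$. If these matrices can be embedded as submatrices in a commuting tuple of $p$ diagonalizable matrices of size $N$ (i.e., there are pairwise commuting matrices $Z_1,\ldots,Z_p\in M_N(K)$, each diagonalizable over $K$, such that $(Z_k)_{ij}=(A_k)_{ij}$ for all $1\le i,j\le n$ and $1\le k\le p$), then $N\ge\operatorname{rank}(T)$, where $T\in K^{n\times n\times p}$ denotes the tensor with $z$-slices $A_1,\ldots,A_p$.
   Context: A tensor of format $m\times n\times p$ over a field $K$ is an array $T=(T_{ijk})\in K^{m\times n\times p}$. Its $k$-th $z$-slice is the $m\times n$ matrix $(T_{ijk})_{i,j}$, for $1\le k\le p$. For $u\in K^m$, $v\in K^n$, $w\in K^p$, the tensor $u\otimes v\otimes w$ has entries $u_iv_jw_k$; it has rank one if $u,v,w\neq 0$. The rank over $K$, $\operatorname{rank}(T)$, is the smallest $r$ such that $T$ is a sum of $r$ rank-one tensors over $K$ (with $\operatorname{rank}(0)=0$). $M_n(K)$ is the set of $n\times n$ matrices over $K$. "Embedded as a submatrix" means appearing in the top-left corner (so $N\ge n$). -}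

module Defs where

open import Level using (Level; _⊔_; 0ℓ) renaming (suc to lsuc)
open import Algebra.Bundles using (CommutativeRing)
import Algebra.Properties.Semiring.Sum as SemiringSum
import Algebra.Solver.Ring.NaturalCoefficients.Default as SemiringSolver
open import Data.Bool.Base using (if_then_else_)
open import Data.Fin.Base using (Fin; zero; suc; inject≤)
import Data.Fin.Properties as Fin
open import Data.Nat.Base as ℕ using (ℕ; zero; suc)
open import Data.Nat.Induction using (<-rec)
import Data.Nat.Properties as ℕ
open import Data.Product.Base using (Σ; ∃-syntax; Σ-syntax; _×_; _,_; proj₁; proj₂)
open import Data.Rational.Base as ℚ using (ℚ; 0ℚ; 1ℚ; ½; ∣_∣)
import Data.Rational.Properties as ℚ
import Data.Rational.Solver as ℚ-Solver
open import Data.Vec.Functional using (Vector)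
open import Function.Base using (_∘_)
open import Relation.Binary.PropositionalEquality
  using (_≡_; _≢_; refl; sym; trans; cong; cong₂; subst; subst₂)
open import Relation.Nullary using (¬_; does)

-- ℝ is the setoid of Cauchy sequences of rationals modulo null sequences.

private
  Close : (ℕ → ℚ) → (ℕ → ℚ) → Set
  Close f g = ∀ ε → 0ℚ ℚ.< ε →
    ∃[ N ] (∀ m n → N ℕ.≤ m → N ℕ.≤ n → ∣ f m ℚ.- g n ∣ ℚ.< ε)

Cauchy : (ℕ → ℚ) → Set
Cauchy f = ∀ ε → 0ℚ ℚ.< ε →
  ∃[ N ] (∀ m n → N ℕ.≤ m → N ℕ.≤ n → ∣ f m ℚ.- f n ∣ ℚ.< ε)

record ℝ : Set where
  constructor mkℝ
  field
    seq    : ℕ → ℚ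
    cauchy : Cauchy seq

open ℝ

infix 4 _≈ℝ_

_≈ℝ_ : ℝ → ℝ → Set
x ≈ℝ y = ∀ ε → 0ℚ ℚ.< ε →
  ∃[ N ] (∀ n → N ℕ.≤ n → ∣ seq x n ℚ.- seq y n ∣ ℚ.< ε)

private
  half : ∀ {ε} → 0ℚ ℚ.< ε → 0ℚ ℚ.< ½ ℚ.* ε
  half {ε} 0<ε = subst (ℚ._< ½ ℚ.* ε) (ℚ.*-zeroʳ ½) (ℚ.*-monoʳ-<-pos ½ 0<ε)

  halves : ∀ ε → ½ ℚ.* ε ℚ.+ ½ ℚ.* ε ≡ ε
  halves ε = trans (sym (ℚ.*-distribʳ-+ ε ½ ½)) (ℚ.*-identityˡ ε)

  ∣p-q∣≡∣q-p∣ : ∀ p q → ∣ p ℚ.- q ∣ ≡ ∣ q ℚ.- p ∣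
  ∣p-q∣≡∣q-p∣ p q = trans (sym (ℚ.∣-p∣≡∣p∣ (p ℚ.- q)))
    (cong ∣_∣ (solve 2 (λ p q → :- (p :- q) := q :- p) refl p q))
    where open ℚ-Solver.+-*-Solver

  ∣p-r∣≤ : ∀ p q r → ∣ p ℚ.- r ∣ ℚ.≤ ∣ p ℚ.- q ∣ ℚ.+ ∣ q ℚ.- r ∣
  ∣p-r∣≤ p q r = subst (λ t → ∣ t ∣ ℚ.≤ ∣ p ℚ.- q ∣ ℚ.+ ∣ q ℚ.- r ∣)
    (solve 3 (λ p q r → (p :- q) :+ (q :- r) := p :- r) refl p q r)
    (ℚ.∣p+q∣≤∣p∣+∣q∣ (p ℚ.- q) (q ℚ.- r))
    where open ℚ-Solver.+-*-Solver

  ∣sums∣≤ : ∀ a b c d → ∣ (a ℚ.+ b) ℚ.- (c ℚ.+ d) ∣ ℚ.≤ ∣ a ℚ.- c ∣ ℚ.+ ∣ b ℚ.- d ∣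
  ∣sums∣≤ a b c d = subst (λ t → ∣ t ∣ ℚ.≤ ∣ a ℚ.- c ∣ ℚ.+ ∣ b ℚ.- d ∣)
    (solve 4 (λ a b c d → (a :- c) :+ (b :- d) := (a :+ b) :- (c :+ d)) refl a b c d)
    (ℚ.∣p+q∣≤∣p∣+∣q∣ (a ℚ.- c) (b ℚ.- d))
    where open ℚ-Solver.+-*-Solver

  ∣products∣≤ : ∀ a b c d →
    ∣ a ℚ.* b ℚ.- c ℚ.* d ∣ ℚ.≤ ∣ a ∣ ℚ.* ∣ b ℚ.- d ∣ ℚ.+ ∣ d ∣ ℚ.* ∣ a ℚ.- c ∣
  ∣products∣≤ a b c d = subst₂ ℚ._≤_
    (cong ∣_∣ (solve 4 (λ a b c d → a :* (b :- d) :+ d :* (a :- c) := a :* b :- c :* d)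
      refl a b c d))
    (cong₂ ℚ._+_ (ℚ.∣p*q∣≡∣p∣*∣q∣ a (b ℚ.- d)) (ℚ.∣p*q∣≡∣p∣*∣q∣ d (a ℚ.- c)))
    (ℚ.∣p+q∣≤∣p∣+∣q∣ (a ℚ.* (b ℚ.- d)) (d ℚ.* (a ℚ.- c)))
    where open ℚ-Solver.+-*-Solver

  <-halves : ∀ {t a b ε} → t ℚ.≤ a ℚ.+ b → a ℚ.< ½ ℚ.* ε → b ℚ.< ½ ℚ.* ε → t ℚ.< ε
  <-halves {t} {a} {b} {ε} t≤ a< b< =
    ℚ.≤-<-trans t≤ (subst (a ℚ.+ b ℚ.<_) (halves ε) (ℚ.+-mono-< a< b<))

  -- For Cauchy sequences, closeness at independent indices and at equal
  -- indices coincide; the former covers the Cauchy condition itself.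
  ≈⇒Close : ∀ {x y} → x ≈ℝ y → Close (seq x) (seq y)
  ≈⇒Close {x} {y} x≈y ε 0<ε = N₁ ℕ.⊔ N₂ , λ m n ≤m ≤n →
      <-halves (∣p-r∣≤ (seq x m) (seq x n) (seq y n))
        (c m n (ℕ.m⊔n≤o⇒m≤o N₁ N₂ ≤m) (ℕ.m⊔n≤o⇒m≤o N₁ N₂ ≤n))
        (e n (ℕ.m⊔n≤o⇒n≤o N₁ N₂ ≤n))
    where
    N₁ = proj₁ (cauchy x (½ ℚ.* ε) (half 0<ε))
    c  = proj₂ (cauchy x (½ ℚ.* ε) (half 0<ε))
    N₂ = proj₁ (x≈y (½ ℚ.* ε) (half 0<ε))
    e  = proj₂ (x≈y (½ ℚ.* ε) (half 0<ε))

  Close⇒≈ : ∀ {x y} → Close (seq x) (seq y) → x ≈ℝ y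
  Close⇒≈ c ε 0<ε = proj₁ (c ε 0<ε) , λ n ≤n → proj₂ (c ε 0<ε) n n ≤n ≤n

  ≗⇒≈ : ∀ {x y} → (∀ n → seq x n ≡ seq y n) → x ≈ℝ y
  ≗⇒≈ {x} {y} eq ε 0<ε = 0 , λ n _ → subst (ℚ._< ε)
    (cong ∣_∣ (sym (trans (cong (ℚ._- seq y n) (eq n)) (ℚ.+-inverseʳ (seq y n))))) 0<ε

  const-cauchy : ∀ q → Cauchy (λ _ → q)
  const-cauchy q ε 0<ε = 0 , λ _ _ _ _ →
    subst (ℚ._< ε) (cong ∣_∣ (sym (ℚ.+-inverseʳ q))) 0<ε

  close-+ : ∀ f f′ g g′ → Close f f′ → Close g g′ →
            Close (λ n → f n ℚ.+ g n) (λ n → f′ n ℚ.+ g′ n)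
  close-+ f f′ g g′ cf cg ε 0<ε = N₁ ℕ.⊔ N₂ , λ m n ≤m ≤n →
      <-halves (∣sums∣≤ (f m) (g m) (f′ n) (g′ n))
        (e₁ m n (ℕ.m⊔n≤o⇒m≤o N₁ N₂ ≤m) (ℕ.m⊔n≤o⇒m≤o N₁ N₂ ≤n))
        (e₂ m n (ℕ.m⊔n≤o⇒n≤o N₁ N₂ ≤m) (ℕ.m⊔n≤o⇒n≤o N₁ N₂ ≤n))
    where
    N₁ = proj₁ (cf (½ ℚ.* ε) (half 0<ε))
    e₁ = proj₂ (cf (½ ℚ.* ε) (half 0<ε))
    N₂ = proj₁ (cg (½ ℚ.* ε) (half 0<ε))
    e₂ = proj₂ (cg (½ ℚ.* ε) (half 0<ε))

  close-neg : ∀ f f′ → Close f f′ → Close (ℚ.-_ ∘ f) (ℚ.-_ ∘ f′)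
  close-neg f f′ c ε 0<ε = proj₁ (c ε 0<ε) , λ m n ≤m ≤n →
      subst (ℚ._< ε) (eq (f m) (f′ n)) (proj₂ (c ε 0<ε) m n ≤m ≤n)
    where
    open ℚ-Solver.+-*-Solver
    eq : ∀ p q → ∣ p ℚ.- q ∣ ≡ ∣ ℚ.- p ℚ.- ℚ.- q ∣
    eq p q = trans (∣p-q∣≡∣q-p∣ p q)
      (cong ∣_∣ (solve 2 (λ p q → q :- p := :- p :- :- q) refl p q))

  EventuallyBounded : (ℕ → ℚ) → Set
  EventuallyBounded f =
    ∃[ B ] 0ℚ ℚ.< B × ∃[ N ] (∀ n → N ℕ.≤ n → ∣ f n ∣ ℚ.≤ B)

  bounded : ∀ f → Cauchy f → EventuallyBounded f
  bounded f c = ∣ f N ∣ ℚ.+ 1ℚ , 0<B , N , λ n ≤n →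
      subst (λ t → ∣ t ∣ ℚ.≤ ∣ f N ∣ ℚ.+ 1ℚ) (eq (f N) (f n))
        (ℚ.≤-trans (ℚ.∣p+q∣≤∣p∣+∣q∣ (f N) (f n ℚ.- f N))
          (ℚ.+-monoʳ-≤ ∣ f N ∣ (ℚ.<⇒≤ (e n N ≤n ℕ.≤-refl))))
    where
    open ℚ-Solver.+-*-Solver
    0<1 : 0ℚ ℚ.< 1ℚ
    0<1 = ℚ.positive⁻¹ 1ℚ
    N = proj₁ (c 1ℚ 0<1)
    e = proj₂ (c 1ℚ 0<1)
    0<B : 0ℚ ℚ.< ∣ f N ∣ ℚ.+ 1ℚ
    0<B = ℚ.+-mono-≤-< (ℚ.0≤∣p∣ (f N)) 0<1
    eq : ∀ p q → p ℚ.+ (q ℚ.- p) ≡ q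
    eq = solve 2 (λ p q → p :+ (q :- p) := q) refl

  scale : ∀ {B} → 0ℚ ℚ.< B → ∀ {ε} → 0ℚ ℚ.< ε →
          ∃[ δ ] 0ℚ ℚ.< δ × (∀ {a b} → ∣ a ∣ ℚ.≤ B → ∣ b ∣ ℚ.< δ → ∣ a ∣ ℚ.* ∣ b ∣ ℚ.< ε)
  scale {B} 0<B {ε} 0<ε = δ , 0<δ , λ {a} {b} a≤ b< →
      ℚ.≤-<-trans
        (ℚ.*-monoʳ-≤-nonNeg ∣ b ∣ {{ℚ.∣-∣-nonNeg b}} a≤)
        (subst (B ℚ.* ∣ b ∣ ℚ.<_) Bδ≡ε (ℚ.*-monoʳ-<-pos B {{pos}} b<))
    where
    pos = ℚ.positive 0<B
    B≢0 = ℚ.pos⇒nonZero B {{pos}}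
    1/B = ℚ.1/_ B {{B≢0}}
    δ = 1/B ℚ.* ε
    0<δ : 0ℚ ℚ.< δ
    0<δ = subst (ℚ._< δ) (ℚ.*-zeroʳ 1/B)
      (ℚ.*-monoʳ-<-pos 1/B {{ℚ.1/pos⇒pos B {{pos}}}} 0<ε)
    Bδ≡ε : B ℚ.* δ ≡ ε
    Bδ≡ε = trans (sym (ℚ.*-assoc B 1/B ε))
      (trans (cong (ℚ._* ε) (ℚ.*-inverseʳ B {{B≢0}})) (ℚ.*-identityˡ ε))

  close-* : ∀ f f′ g g′ → EventuallyBounded f → EventuallyBounded g′ →
            Close f f′ → Close g g′ →
            Close (λ n → f n ℚ.* g n) (λ n → f′ n ℚ.* g′ n)
  close-* f f′ g g′ (B , 0<B , N₁ , b₁) (C , 0<C , N₂ , b₂) cf cg ε 0<ε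
    with scale 0<B (half 0<ε) | scale 0<C (half 0<ε)
  ... | δ , 0<δ , s₁ | η , 0<η , s₂ with cf η 0<η | cg δ 0<δ
  ... | N₃ , e₃ | N₄ , e₄ = (N₁ ℕ.⊔ N₂) ℕ.⊔ (N₃ ℕ.⊔ N₄) , λ m n ≤m ≤n →
      <-halves (∣products∣≤ (f m) (g m) (f′ n) (g′ n))
        (s₁ (b₁ m (ℕ.m⊔n≤o⇒m≤o N₁ N₂ (l ≤m)))
            (e₄ m n (ℕ.m⊔n≤o⇒n≤o N₃ N₄ (r ≤m)) (ℕ.m⊔n≤o⇒n≤o N₃ N₄ (r ≤n))))
        (s₂ (b₂ n (ℕ.m⊔n≤o⇒n≤o N₁ N₂ (l ≤n)))
            (e₃ m n (ℕ.m⊔n≤o⇒m≤o N₃ N₄ (r ≤m)) (ℕ.m⊔n≤o⇒m≤o N₃ N₄ (r ≤n))))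
    where
    l : ∀ {k} → (N₁ ℕ.⊔ N₂) ℕ.⊔ (N₃ ℕ.⊔ N₄) ℕ.≤ k → N₁ ℕ.⊔ N₂ ℕ.≤ k
    l = ℕ.m⊔n≤o⇒m≤o (N₁ ℕ.⊔ N₂) (N₃ ℕ.⊔ N₄)
    r : ∀ {k} → (N₁ ℕ.⊔ N₂) ℕ.⊔ (N₃ ℕ.⊔ N₄) ℕ.≤ k → N₃ ℕ.⊔ N₄ ℕ.≤ k
    r = ℕ.m⊔n≤o⇒n≤o (N₁ ℕ.⊔ N₂) (N₃ ℕ.⊔ N₄)

infixl 6 _+ℝ_
infixl 7 _*ℝ_
infix  8 -ℝ_

_+ℝ_ : ℝ → ℝ → ℝ
x +ℝ y = mkℝ (λ n → seq x n ℚ.+ seq y n)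
  (close-+ (seq x) (seq x) (seq y) (seq y) (cauchy x) (cauchy y))

-ℝ_ : ℝ → ℝ
-ℝ x = mkℝ (λ n → ℚ.- seq x n) (close-neg (seq x) (seq x) (cauchy x))

_*ℝ_ : ℝ → ℝ → ℝ
x *ℝ y = mkℝ (λ n → seq x n ℚ.* seq y n)
  (close-* (seq x) (seq x) (seq y) (seq y)
    (bounded (seq x) (cauchy x)) (bounded (seq y) (cauchy y)) (cauchy x) (cauchy y))

fromℚ : ℚ → ℝ
fromℚ q = mkℝ (λ _ → q) (const-cauchy q)

private
  ≈ℝ-sym : ∀ {x y} → x ≈ℝ y → y ≈ℝ x
  ≈ℝ-sym {x} {y} e ε 0<ε = proj₁ (e ε 0<ε) , λ n ≤n →
    subst (ℚ._< ε) (∣p-q∣≡∣q-p∣ (seq x n) (seq y n)) (proj₂ (e ε 0<ε) n ≤n)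

  ≈ℝ-trans : ∀ {x y z} → x ≈ℝ y → y ≈ℝ z → x ≈ℝ z
  ≈ℝ-trans {x} {y} {z} e f ε 0<ε = N₁ ℕ.⊔ N₂ , λ n ≤n →
      <-halves (∣p-r∣≤ (seq x n) (seq y n) (seq z n))
        (proj₂ (e (½ ℚ.* ε) (half 0<ε)) n (ℕ.m⊔n≤o⇒m≤o N₁ N₂ ≤n))
        (proj₂ (f (½ ℚ.* ε) (half 0<ε)) n (ℕ.m⊔n≤o⇒n≤o N₁ N₂ ≤n))
    where
    N₁ = proj₁ (e (½ ℚ.* ε) (half 0<ε))
    N₂ = proj₁ (f (½ ℚ.* ε) (half 0<ε))

  +ℝ-cong : ∀ {x x′ y y′} → x ≈ℝ x′ → y ≈ℝ y′ → x +ℝ y ≈ℝ x′ +ℝ y′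
  +ℝ-cong {x} {x′} {y} {y′} e f =
    Close⇒≈ {x +ℝ y} {x′ +ℝ y′} (close-+ (seq x) (seq x′) (seq y) (seq y′)
      (≈⇒Close {x} {x′} e) (≈⇒Close {y} {y′} f))

  -ℝ-cong : ∀ {x x′} → x ≈ℝ x′ → -ℝ x ≈ℝ -ℝ x′
  -ℝ-cong {x} {x′} e = Close⇒≈ { -ℝ x} { -ℝ x′}
    (close-neg (seq x) (seq x′) (≈⇒Close {x} {x′} e))

  *ℝ-cong : ∀ {x x′ y y′} → x ≈ℝ x′ → y ≈ℝ y′ → x *ℝ y ≈ℝ x′ *ℝ y′
  *ℝ-cong {x} {x′} {y} {y′} e f = Close⇒≈ {x *ℝ y} {x′ *ℝ y′}
    (close-* (seq x) (seq x′) (seq y) (seq y′)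
      (bounded (seq x) (cauchy x)) (bounded (seq y′) (cauchy y′))
      (≈⇒Close {x} {x′} e) (≈⇒Close {y} {y′} f))

ℝ-commutativeRing : CommutativeRing 0ℓ 0ℓ
ℝ-commutativeRing = record
  { Carrier = ℝ
  ; _≈_ = _≈ℝ_
  ; _+_ = _+ℝ_
  ; _*_ = _*ℝ_
  ; -_ = -ℝ_
  ; 0# = fromℚ 0ℚ
  ; 1# = fromℚ 1ℚ
  ; isCommutativeRing = record
    { isRing = record
      { +-isAbelianGroup = record
        { isGroup = record
          { isMonoid = record
            { isSemigroup = record
              { isMagma = record
                { isEquivalence = record
                  { refl  = λ {x} → ≗⇒≈ {x} {x} λ _ → refl
                  ; sym   = λ {x} {y} → ≈ℝ-sym {x} {y}
                  ; trans = λ {x} {y} {z} → ≈ℝ-trans {x} {y} {z}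
                  }
                ; ∙-cong = λ {x} {x′} {y} {y′} → +ℝ-cong {x} {x′} {y} {y′}
                }
              ; assoc = λ x y z → ≗⇒≈ {x +ℝ y +ℝ z} {x +ℝ (y +ℝ z)}
                  λ n → ℚ.+-assoc (seq x n) (seq y n) (seq z n)
              }
            ; identity =
                (λ x → ≗⇒≈ {fromℚ 0ℚ +ℝ x} {x} λ n → ℚ.+-identityˡ (seq x n))
              , (λ x → ≗⇒≈ {x +ℝ fromℚ 0ℚ} {x} λ n → ℚ.+-identityʳ (seq x n))
            }
          ; inverse =
              (λ x → ≗⇒≈ { -ℝ x +ℝ x} {fromℚ 0ℚ} λ n → ℚ.+-inverseˡ (seq x n))
            , (λ x → ≗⇒≈ {x +ℝ -ℝ x} {fromℚ 0ℚ} λ n → ℚ.+-inverseʳ (seq x n))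
          ; ⁻¹-cong = λ {x} {x′} → -ℝ-cong {x} {x′}
          }
        ; comm = λ x y → ≗⇒≈ {x +ℝ y} {y +ℝ x} λ n → ℚ.+-comm (seq x n) (seq y n)
        }
      ; *-cong = λ {x} {x′} {y} {y′} → *ℝ-cong {x} {x′} {y} {y′}
      ; *-assoc = λ x y z → ≗⇒≈ {x *ℝ y *ℝ z} {x *ℝ (y *ℝ z)}
          λ n → ℚ.*-assoc (seq x n) (seq y n) (seq z n)
      ; *-identity =
          (λ x → ≗⇒≈ {fromℚ 1ℚ *ℝ x} {x} λ n → ℚ.*-identityˡ (seq x n))
        , (λ x → ≗⇒≈ {x *ℝ fromℚ 1ℚ} {x} λ n → ℚ.*-identityʳ (seq x n))
      ; distrib =
          (λ x y z → ≗⇒≈ {x *ℝ (y +ℝ z)} {x *ℝ y +ℝ x *ℝ z}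
            λ n → ℚ.*-distribˡ-+ (seq x n) (seq y n) (seq z n))
        , (λ x y z → ≗⇒≈ {(y +ℝ z) *ℝ x} {y *ℝ x +ℝ z *ℝ x}
            λ n → ℚ.*-distribʳ-+ (seq x n) (seq y n) (seq z n))
      }
    ; *-comm = λ x y → ≗⇒≈ {x *ℝ y} {y *ℝ x} λ n → ℚ.*-comm (seq x n) (seq y n)
    }
  }

-- R[X]/(X² − s) for a commutative ring R; the pair (a , b) stands for a + bX.
module AdjoinSqrt {c ℓ} (R : CommutativeRing c ℓ) (s : CommutativeRing.Carrier R) where

  open CommutativeRing R
    renaming (refl to ≈-refl; sym to ≈-sym; trans to ≈-trans)

  private
    open SemiringSolver commutativeSemiring
      using (solve; _:=_; _:+_; _:*_; con; Polynomial)

    re im : ∀ {n} (s a b c d : Polynomial n) → Polynomial n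
    re s a b c d = a :* c :+ s :* (b :* d)
    im s a b c d = a :* d :+ b :* c

  commutativeRing : CommutativeRing c ℓ
  commutativeRing = record
    { Carrier = Carrier × Carrier
    ; _≈_ = λ (a , b) (c , d) → a ≈ c × b ≈ d
    ; _+_ = λ (a , b) (c , d) → a + c , b + d
    ; _*_ = λ (a , b) (c , d) → a * c + s * (b * d) , a * d + b * c
    ; -_ = λ (a , b) → - a , - b
    ; 0# = 0# , 0#
    ; 1# = 1# , 0#
    ; isCommutativeRing = record
      { isRing = record
        { +-isAbelianGroup = record
          { isGroup = record
            { isMonoid = record
              { isSemigroup = record
                { isMagma = record
                  { isEquivalence = record
                    { refl  = ≈-refl , ≈-refl
                    ; sym   = λ (p , q) → ≈-sym p , ≈-sym q
                    ; trans = λ (p , q) (p′ , q′) → ≈-trans p p′ , ≈-trans q q′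
                    }
                  ; ∙-cong = λ (p , q) (p′ , q′) → +-cong p p′ , +-cong q q′
                  }
                ; assoc = λ (a , b) (c , d) (e , f) → +-assoc a c e , +-assoc b d f
                }
              ; identity = (λ (a , b) → +-identityˡ a , +-identityˡ b)
                         , (λ (a , b) → +-identityʳ a , +-identityʳ b)
              }
            ; inverse = (λ (a , b) → -‿inverseˡ a , -‿inverseˡ b)
                      , (λ (a , b) → -‿inverseʳ a , -‿inverseʳ b)
            ; ⁻¹-cong = λ (p , q) → -‿cong p , -‿cong q
            }
          ; comm = λ (a , b) (c , d) → +-comm a c , +-comm b d
          }
        ; *-cong = λ (p , q) (p′ , q′) →
              +-cong (*-cong p p′) (*-congˡ (*-cong q q′))
            , +-cong (*-cong p q′) (*-cong q p′)
        ; *-assoc = λ (a , b) (c , d) (e , f) →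
              solve 7 (λ s a b c d e f →
                  re s (re s a b c d) (im s a b c d) e f
                  := re s a b (re s c d e f) (im s c d e f))
                ≈-refl s a b c d e f
            , solve 7 (λ s a b c d e f →
                  im s (re s a b c d) (im s a b c d) e f
                  := im s a b (re s c d e f) (im s c d e f))
                ≈-refl s a b c d e f
        ; *-identity = (λ (a , b) →
              solve 3 (λ s a b → re s (con 1) (con 0) a b := a) ≈-refl s a b
            , solve 3 (λ s a b → im s (con 1) (con 0) a b := b) ≈-refl s a b)
          , (λ (a , b) →
              solve 3 (λ s a b → re s a b (con 1) (con 0) := a) ≈-refl s a b
            , solve 3 (λ s a b → im s a b (con 1) (con 0) := b) ≈-refl s a b)
        ; distrib = (λ (a , b) (c , d) (e , f) →
              solve 7 (λ s a b c d e f →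
                  re s a b (c :+ e) (d :+ f) := re s a b c d :+ re s a b e f)
                ≈-refl s a b c d e f
            , solve 7 (λ s a b c d e f →
                  im s a b (c :+ e) (d :+ f) := im s a b c d :+ im s a b e f)
                ≈-refl s a b c d e f)
          , (λ (a , b) (c , d) (e , f) →
              solve 7 (λ s a b c d e f →
                  re s (c :+ e) (d :+ f) a b := re s c d a b :+ re s e f a b)
                ≈-refl s a b c d e f
            , solve 7 (λ s a b c d e f →
                  im s (c :+ e) (d :+ f) a b := im s c d a b :+ im s e f a b)
                ≈-refl s a b c d e f)
        }
      ; *-comm = λ (a , b) (c , d) →
            solve 5 (λ s a b c d → re s a b c d := re s c d a b) ≈-refl s a b c d
          , solve 5 (λ s a b c d → im s a b c d := im s c d a b) ≈-refl s a b c d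
      }
    }

ℂ-commutativeRing : CommutativeRing 0ℓ 0ℓ
ℂ-commutativeRing = AdjoinSqrt.commutativeRing ℝ-commutativeRing (-ℝ fromℚ 1ℚ)

-- F is meant to be a field; only its ring structure is needed here.
record Subfield {c ℓ} (F : CommutativeRing c ℓ) (k : Level) : Set (c ⊔ ℓ ⊔ lsuc k) where
  private module F = CommutativeRing F

  field
    _∈K     : F.Carrier → Set k
    ∈K-resp : ∀ {x y} → x F.≈ y → x ∈K → y ∈K
    0∈K     : F.0# ∈K
    1∈K     : F.1# ∈K
    +-closed : ∀ {x y} → x ∈K → y ∈K → (x F.+ y) ∈K
    *-closed : ∀ {x y} → x ∈K → y ∈K → (x F.* y) ∈K
    neg-closed : ∀ {x} → x ∈K → (F.- x) ∈K
    inv-closed : ∀ {x} → x ∈K → ¬ (x F.≈ F.0#) → ∃[ y ] y ∈K × x F.* y F.≈ F.1#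

  -- K as a ring in its own right, with the equality of F.
  commutativeRing : CommutativeRing (c ⊔ k) ℓ
  commutativeRing = record
    { Carrier = Σ F.Carrier _∈K
    ; _≈_ = λ x y → proj₁ x F.≈ proj₁ y
    ; _+_ = λ (x , p) (y , q) → x F.+ y , +-closed p q
    ; _*_ = λ (x , p) (y , q) → x F.* y , *-closed p q
    ; -_ = λ (x , p) → F.- x , neg-closed p
    ; 0# = F.0# , 0∈K
    ; 1# = F.1# , 1∈K
    ; isCommutativeRing = record
      { isRing = record
        { +-isAbelianGroup = record
          { isGroup = record
            { isMonoid = record
              { isSemigroup = record
                { isMagma = record
                  { isEquivalence = record
                    { refl  = λ {x} → F.refl {proj₁ x}
                    ; sym   = λ {x} {y} → F.sym {proj₁ x} {proj₁ y}
                    ; trans = λ {x} {y} {z} → F.trans {proj₁ x} {proj₁ y} {proj₁ z}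
                    }
                  ; ∙-cong = λ {x} {x′} {y} {y′} →
                      F.+-cong {proj₁ x} {proj₁ x′} {proj₁ y} {proj₁ y′}
                  }
                ; assoc = λ (x , _) (y , _) (z , _) → F.+-assoc x y z
                }
              ; identity = (λ (x , _) → F.+-identityˡ x) , (λ (x , _) → F.+-identityʳ x)
              }
            ; inverse = (λ (x , _) → F.-‿inverseˡ x) , (λ (x , _) → F.-‿inverseʳ x)
            ; ⁻¹-cong = λ {x} {y} → F.-‿cong {proj₁ x} {proj₁ y}
            }
          ; comm = λ (x , _) (y , _) → F.+-comm x y
          }
        ; *-cong = λ {x} {x′} {y} {y′} →
            F.*-cong {proj₁ x} {proj₁ x′} {proj₁ y} {proj₁ y′}
        ; *-assoc = λ (x , _) (y , _) (z , _) → F.*-assoc x y z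
        ; *-identity = (λ (x , _) → F.*-identityˡ x) , (λ (x , _) → F.*-identityʳ x)
        ; distrib = (λ (x , _) (y , _) (z , _) → F.distribˡ x y z)
                  , (λ (x , _) (y , _) (z , _) → F.distribʳ x y z)
        }
      ; *-comm = λ (x , _) (y , _) → F.*-comm x y
      }
    }

module LinearAlgebra {c ℓ} (R : CommutativeRing c ℓ) where

  open CommutativeRing R
    hiding (zero)
    renaming (refl to ≈-refl; sym to ≈-sym; trans to ≈-trans)
  open SemiringSum semiring using (sum-syntax)

  Matrix : ℕ → ℕ → Set c
  Matrix m n = Fin m → Fin n → Carrier

  infix  4 _≈ᴹ_ _≈ᵀ_
  infixl 7 _*ᴹ_

  _≈ᴹ_ : ∀ {m n} → Matrix m n → Matrix m n → Set ℓ
  A ≈ᴹ B = ∀ i j → A i j ≈ B i j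

  _*ᴹ_ : ∀ {l m n} → Matrix l m → Matrix m n → Matrix l n
  _*ᴹ_ {m = m} A B i j = ∑[ k < m ] (A i k * B k j)

  1ᴹ : ∀ {n} → Matrix n n
  1ᴹ i j = if does (i Fin.≟ j) then 1# else 0#

  IsDiagonal : ∀ {n} → Matrix n n → Set ℓ
  IsDiagonal D = ∀ i j → i ≢ j → D i j ≈ 0#

  record Diagonalizable {n} (Z : Matrix n n) : Set (c ⊔ ℓ) where
    field
      P P⁻¹ D  : Matrix n n
      inverseʳ : P *ᴹ P⁻¹ ≈ᴹ 1ᴹ
      inverseˡ : P⁻¹ *ᴹ P ≈ᴹ 1ᴹ
      diagonal : IsDiagonal D
      Z≈PDP⁻¹  : Z ≈ᴹ P *ᴹ D *ᴹ P⁻¹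

  PairwiseCommuting : ∀ {n p} → (Fin p → Matrix n n) → Set ℓ
  PairwiseCommuting Z = ∀ k l → Z k *ᴹ Z l ≈ᴹ Z l *ᴹ Z k

  IsTopLeftOf : ∀ {n N} → n ℕ.≤ N → Matrix n n → Matrix N N → Set ℓ
  IsTopLeftOf n≤N A Z = ∀ i j → Z (inject≤ i n≤N) (inject≤ j n≤N) ≈ A i j

  Tensor : ℕ → ℕ → ℕ → Set c
  Tensor m n p = Fin m → Fin n → Fin p → Carrier

  _≈ᵀ_ : ∀ {m n p} → Tensor m n p → Tensor m n p → Set ℓ
  S ≈ᵀ T = ∀ i j k → S i j k ≈ T i j k

  fromSlices : ∀ {m n p} → (Fin p → Matrix m n) → Tensor m n p
  fromSlices A i j k = A k i j

  NonZeroVector : ∀ {n} → Vector Carrier n → Set ℓ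
  NonZeroVector u = ¬ (∀ i → u i ≈ 0#)

  infix 6 _⊗_⊗_
  _⊗_⊗_ : ∀ {m n p} → Vector Carrier m → Vector Carrier n → Vector Carrier p →
          Tensor m n p
  (u ⊗ v ⊗ w) i j k = u i * v j * w k

  IsRankOne : ∀ {m n p} → Tensor m n p → Set (c ⊔ ℓ)
  IsRankOne T = ∃[ u ] ∃[ v ] ∃[ w ]
    NonZeroVector u × NonZeroVector v × NonZeroVector w × T ≈ᵀ (u ⊗ v ⊗ w)

  ∑ᵀ : ∀ {m n p r} → (Fin r → Tensor m n p) → Tensor m n p
  ∑ᵀ {r = r} t i j k = ∑[ s < r ] t s i j k

  IsSumOfRankOnes : ∀ {m n p} → Tensor m n p → ℕ → Set (c ⊔ ℓ)
  IsSumOfRankOnes {m} {n} {p} T r =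
    Σ[ t ∈ (Fin r → Tensor m n p) ] (∀ s → IsRankOne (t s)) × T ≈ᵀ ∑ᵀ t

  -- Computing the rank as a function would require excluded middle, so
  -- rank(T) = r is expressed as a relation; by `hasRank-unique` and
  -- `¬¬hasRank` below it is, classically, the graph of a total function.
  HasRank : ∀ {m n p} → Tensor m n p → ℕ → Set (c ⊔ ℓ)
  HasRank T r = IsSumOfRankOnes T r × (∀ s → IsSumOfRankOnes T s → r ℕ.≤ s)

  hasRank-unique : ∀ {m n p} {T : Tensor m n p} {r s} →
                   HasRank T r → HasRank T s → r ≡ s
  hasRank-unique (d , min) (d′ , min′) = ℕ.≤-antisym (min _ d′) (min′ _ d)

  private
    ¬¬Sum : ∀ {m n p} → Tensor m n p → Set (c ⊔ ℓ)
    ¬¬Sum T = ¬ ¬ (∃[ r ] IsSumOfRankOnes T r)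

    ¬¬Sum-resp : ∀ {m n p} {S T : Tensor m n p} → S ≈ᵀ T → ¬¬Sum S → ¬¬Sum T
    ¬¬Sum-resp e h k = h λ (r , t , o , q) →
      k (r , t , o , λ i j l → ≈-trans (≈-sym (e i j l)) (q i j l))

    ¬¬Sum-0 : ∀ {m n p} → ¬¬Sum {m} {n} {p} (λ _ _ _ → 0#)
    ¬¬Sum-0 k = k (0 , (λ ()) , (λ ()) , λ _ _ _ → ≈-refl)

    sum-+ : ∀ {m n p} r {S T : Tensor m n p} {s} →
            IsSumOfRankOnes S r → IsSumOfRankOnes T s →
            IsSumOfRankOnes (λ i j k → S i j k + T i j k) (r ℕ.+ s)
    sum-+ zero (_ , _ , e) (t , o , f) = t , o , λ i j k →
      ≈-trans (+-congʳ (e i j k)) (≈-trans (+-identityˡ _) (f i j k))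
    sum-+ (suc r) {S} {T} (t , o , e) d
      with sum-+ r {S = ∑ᵀ (t ∘ suc)} (t ∘ suc , o ∘ suc , λ _ _ _ → ≈-refl) d
    ... | t′ , o′ , e′ =
        (λ { zero → t zero ; (suc s) → t′ s })
      , (λ { zero → o zero ; (suc s) → o′ s })
      , λ i j k → ≈-trans (+-congʳ (e i j k))
          (≈-trans (+-assoc _ _ _) (+-congˡ (e′ i j k)))

    ¬¬Sum-+ : ∀ {m n p} {S T : Tensor m n p} → ¬¬Sum S → ¬¬Sum T →
              ¬¬Sum (λ i j k → S i j k + T i j k)
    ¬¬Sum-+ g h k = g λ (r , d) → h λ (s , d′) → k (r ℕ.+ s , sum-+ r d d′)

    ¬¬Sum-∑ : ∀ {m n p} r (t : Fin r → Tensor m n p) → (∀ s → ¬¬Sum (t s)) →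
              ¬¬Sum (∑ᵀ t)
    ¬¬Sum-∑ zero    t h = ¬¬Sum-0
    ¬¬Sum-∑ (suc r) t h = ¬¬Sum-+ (h zero) (¬¬Sum-∑ r (t ∘ suc) (h ∘ suc))

    ¬¬Sum-⊗ : ∀ {m n p} (u : Vector Carrier m) (v : Vector Carrier n)
              (w : Vector Carrier p) → ¬¬Sum (u ⊗ v ⊗ w)
    ¬¬Sum-⊗ u v w k = k (1 , (λ _ → u ⊗ v ⊗ w)
        , (λ _ → u , v , w , u≉0 , v≉0 , w≉0 , λ _ _ _ → ≈-refl)
        , λ _ _ _ → ≈-sym (+-identityʳ _))
      where
      vanish : ¬ (∀ i j l → 0# ≈ (u ⊗ v ⊗ w) i j l)
      vanish e = ¬¬Sum-resp e ¬¬Sum-0 k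
      u≉0 : NonZeroVector u
      u≉0 z = vanish λ i j l → ≈-sym (≈-trans (*-congʳ
        (≈-trans (*-congʳ (z i)) (zeroˡ _))) (zeroˡ _))
      v≉0 : NonZeroVector v
      v≉0 z = vanish λ i j l → ≈-sym (≈-trans (*-congʳ
        (≈-trans (*-congˡ (z j)) (zeroʳ _))) (zeroˡ _))
      w≉0 : NonZeroVector w
      w≉0 z = vanish λ i j l → ≈-sym (≈-trans (*-congˡ (z l)) (zeroʳ _))

    ∑-1ᴹ : ∀ n (f : Vector Carrier n) i → ∑[ s < n ] (1ᴹ s i * f s) ≈ f i
    ∑-1ᴹ (suc n) f zero = ≈-trans (+-cong (*-identityˡ _) (zeros n (f ∘ suc)))
      (+-identityʳ _)
      where
      zeros : ∀ m (g : Vector Carrier m) → ∑[ s < m ] (0# * g s) ≈ 0#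
      zeros zero    g = ≈-refl
      zeros (suc m) g = ≈-trans (+-cong (zeroˡ _) (zeros m (g ∘ suc))) (+-identityʳ _)
    ∑-1ᴹ (suc n) f (suc i) = ≈-trans (+-cong (zeroˡ _) (∑-1ᴹ n (f ∘ suc) i))
      (+-identityˡ _)

    ¬¬Sum-all : ∀ {m n p} (T : Tensor m n p) → ¬¬Sum T
    ¬¬Sum-all {m} {n} {p} T = ¬¬Sum-resp expand
        (¬¬Sum-∑ m _ λ a → ¬¬Sum-∑ n _ λ b → ¬¬Sum-⊗ (1ᴹ a) (1ᴹ b) (T a b))
      where
      open SemiringSum semiring using (sum-cong-≋; *-distribˡ-sum)
      expand : ∀ i j k →
        ∑[ a < m ] ∑[ b < n ] (1ᴹ a i * 1ᴹ b j * T a b k) ≈ T i j k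
      expand i j k = ≈-trans
        (sum-cong-≋ λ a → ≈-trans
          (sum-cong-≋ λ b → *-assoc (1ᴹ a i) (1ᴹ b j) (T a b k))
          (≈-trans (≈-sym (*-distribˡ-sum (1ᴹ a i) (λ b → 1ᴹ b j * T a b k)))
            (*-congˡ (∑-1ᴹ n (λ b → T a b k) j))))
        (∑-1ᴹ m (λ a → T a j k) i)

  ¬¬hasRank : ∀ {m n p} (T : Tensor m n p) → ¬ ¬ (∃[ r ] HasRank T r)
  ¬¬hasRank T k = ¬¬Sum-all T λ (r , d) → none r d
    where
    none : ∀ r → ¬ IsSumOfRankOnes T r
    none = <-rec _ λ r rec d →
      k (r , d , λ s d′ → ℕ.≮⇒≥ λ s<r → rec s<r d′)

{-# OPTIONS --safe #-}

-- The common eigenvectors of commuting diagonalizable matrices span K^N, since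
-- every vector splits successively along the spectral projections of each Z_k.
-- So at most N of them, b_1, …, b_M, already span K^N.  If Z_k b_q = λ_kq b_q
-- and e_j = Σ_q y_qj b_q, then (Z_k)_ij = Σ_q (b_q)_i y_qj λ_kq, which writes
-- the tensor as a sum of at most N tensors of rank at most one.
--
-- Equality in ℂ is undecidable, but N ≥ r is a stable proposition, so the
-- existence statements are only established up to double negation.

module Submission where

open import Defs
open import Data.Nat.Base using (ℕ; _≤_; _≥_)
open import Data.Fin.Base using (Fin)
open import Algebra.Bundles using (CommutativeRing)
import Algebra.Properties.Group as GroupProperties
import Algebra.Properties.Ring as RingProperties
import Algebra.Properties.Semiring.Sum as SemiringSum
import Algebra.Solver.Ring.NaturalCoefficients.Default as SemiringSolver
open import Data.Fin.Base using (zero; suc; inject≤)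
import Data.Fin.Properties as Fin
open import Data.Nat.Base using (zero; suc; z≤n; s≤s)
import Data.Nat.Properties as ℕ
open import Data.Product.Base using (∃-syntax; Σ-syntax; _×_; _,_; proj₁; proj₂)
open import Data.Vec.Functional using (Vector)
open import Effect.Monad using (RawMonad)
open import Function.Base using (_∘_)
open import Level using (Level; _⊔_)
open import Relation.Binary.PropositionalEquality.Core as ≡ using (_≡_; _≢_)
open import Relation.Nullary.Decidable
  using (Dec; yes; no; decidable-stable; dec-true; dec-false; ¬¬-excluded-middle)
open import Relation.Nullary.Negation using (¬_; contradiction; ¬¬-map; ¬¬-Monad)
import Relation.Binary.Reasoning.Setoid as SetoidReasoning

-- Double negation as a monad

private
  variable
    a b : Level

-- RawMonad fixes one universe level, whereas the steps below mix several.
_>>=_ : {A : Set a} {B : Set b} → ¬ ¬ A → (A → ¬ ¬ B) → ¬ ¬ B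
(m >>= f) ¬b = m λ x → f x ¬b

return : {A : Set a} → A → ¬ ¬ A
return = contradiction

-- Finiteness of the index makes this provable: the double negations are discharged one after
-- another. For arbitrary index types it would be double-negation shift.
¬¬-∀ : ∀ {n} {P : Fin n → Set a} → (∀ i → ¬ ¬ P i) → ¬ ¬ (∀ i → P i)
¬¬-∀ = Fin.sequence (RawMonad.rawApplicative ¬¬-Monad)

HasInverses : ∀ {c ℓ} → CommutativeRing c ℓ → Set (c ⊔ ℓ)
HasInverses R = ∀ x → ¬ x ≈ 0# → ∃[ y ] x * y ≈ 1#
  where open CommutativeRing R

subfield-hasInverses : ∀ {c ℓ k} {F : CommutativeRing c ℓ} (K : Subfield F k) →
                       HasInverses (Subfield.commutativeRing K)
subfield-hasInverses K (x , x∈K) x≉0 with Subfield.inv-closed K x∈K x≉0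
... | y , y∈K , xy≈1 = (y , y∈K) , xy≈1

module FieldAlgebra {c ℓ} (R : CommutativeRing c ℓ) (inverse : HasInverses R) where

  open CommutativeRing R hiding (zero)
  open LinearAlgebra R
  open SemiringSum semiring
  open RingProperties ring using (-‿distribˡ-*; [y-z]x≈yx-zx)
  open GroupProperties +-group using (x∙y⁻¹≈ε⇒x≈y; x≈y⇒x∙y⁻¹≈ε)
  open SetoidReasoning setoid
  open SemiringSolver commutativeSemiring using (solve; _:=_; _:+_; _:*_)

  -- Matrix and vector algebra

  infix  4 _≋_
  infixr 7 _·_ _∙_ _⊙_

  _≋_ : ∀ {n} → Vector Carrier n → Vector Carrier n → Set ℓ
  v ≋ w = ∀ i → v i ≈ w i

  _·_ : ∀ {m n} → Matrix m n → Vector Carrier n → Vector Carrier m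
  (A · v) i = ∑[ k < _ ] (A i k * v k)

  _∙_ : ∀ {n} → Carrier → Vector Carrier n → Vector Carrier n
  (x ∙ v) i = x * v i

  ∑ⱽ : ∀ {m n} → (Fin m → Vector Carrier n) → Vector Carrier n
  ∑ⱽ f i = ∑[ j < _ ] f j i

  -- The product `diag(d) A`, kept as a row scaling so that no sums over off-diagonal zeros arise.
  _⊙_ : ∀ {m n} → Vector Carrier m → Matrix m n → Matrix m n
  (d ⊙ A) i j = d i * A i j

  sum-zero : ∀ {n} (f : Vector Carrier n) → (∀ i → f i ≈ 0#) → sum f ≈ 0#
  sum-zero {n} f f≈0 = trans (sum-cong-≋ f≈0) (sum-replicate-zero n)

  sum-single : ∀ {n} (f : Vector Carrier n) i → (∀ k → k ≢ i → f k ≈ 0#) → sum f ≈ f i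
  sum-single {suc n} f zero e = begin
    f zero + sum (f ∘ suc)  ≈⟨ +-congˡ (sum-zero _ λ k → e (suc k) λ ()) ⟩
    f zero + 0#             ≈⟨ +-identityʳ _ ⟩
    f zero                  ∎
  sum-single {suc n} f (suc i) e = begin
    f zero + sum (f ∘ suc)
      ≈⟨ +-cong (e zero λ ()) (sum-single (f ∘ suc) i λ k k≢i → e (suc k) (k≢i ∘ Fin.suc-injective)) ⟩
    0# + f (suc i)  ≈⟨ +-identityˡ _ ⟩
    f (suc i)       ∎

  1ᴹ-diagonal : ∀ {n} (i : Fin n) → 1ᴹ i i ≈ 1#
  1ᴹ-diagonal i rewrite dec-true (i Fin.≟ i) ≡.refl = refl

  1ᴹ-isDiagonal : ∀ {n} → IsDiagonal (1ᴹ {n})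
  1ᴹ-isDiagonal i j i≢j rewrite dec-false (i Fin.≟ j) i≢j = refl

  diagonal-*ᴹ : ∀ {m n} {D : Matrix m m} → IsDiagonal D → (A : Matrix m n) →
                D *ᴹ A ≈ᴹ (λ i → D i i) ⊙ A
  diagonal-*ᴹ diag A i j = sum-single _ i λ k k≢i →
    trans (*-congʳ (diag i k (k≢i ∘ ≡.sym))) (zeroˡ _)

  *ᴹ-diagonal : ∀ {m n} {D : Matrix n n} → IsDiagonal D → (A : Matrix m n) → ∀ i j →
                (A *ᴹ D) i j ≈ A i j * D j j
  *ᴹ-diagonal diag A i j = sum-single _ j λ k k≢j →
    trans (*-congˡ (diag k j k≢j)) (zeroʳ _)

  ≈ᴹ-sym : ∀ {m n} {A B : Matrix m n} → A ≈ᴹ B → B ≈ᴹ A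
  ≈ᴹ-sym e i j = sym (e i j)

  infixr 4 _⨾_
  _⨾_ : ∀ {m n} {A B C : Matrix m n} → A ≈ᴹ B → B ≈ᴹ C → A ≈ᴹ C
  (e ⨾ e′) i j = trans (e i j) (e′ i j)

  *ᴹ-congˡ : ∀ {l m n} (A : Matrix l m) {B C : Matrix m n} → B ≈ᴹ C → A *ᴹ B ≈ᴹ A *ᴹ C
  *ᴹ-congˡ A e i j = sum-cong-≋ λ k → *-congˡ (e k j)

  *ᴹ-congʳ : ∀ {l m n} {A B : Matrix l m} (C : Matrix m n) → A ≈ᴹ B → A *ᴹ C ≈ᴹ B *ᴹ C
  *ᴹ-congʳ C e i j = sum-cong-≋ λ k → *-congʳ (e i k)

  *ᴹ-assoc : ∀ {k l m n} (A : Matrix k l) (B : Matrix l m) (C : Matrix m n) →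
             (A *ᴹ B) *ᴹ C ≈ᴹ A *ᴹ (B *ᴹ C)
  *ᴹ-assoc A B C i j = begin
    ∑[ s < _ ] (∑[ t < _ ] (A i t * B t s) * C s j)
      ≈⟨ sum-cong-≋ (λ s → trans (*-distribʳ-sum (C s j) (λ t → A i t * B t s))
           (sum-cong-≋ λ t → *-assoc (A i t) (B t s) (C s j))) ⟩
    ∑[ s < _ ] ∑[ t < _ ] (A i t * (B t s * C s j))
      ≈⟨ ∑-comm (λ s t → A i t * (B t s * C s j)) ⟩
    ∑[ t < _ ] ∑[ s < _ ] (A i t * (B t s * C s j))
      ≈⟨ sum-cong-≋ (λ t → *-distribˡ-sum (A i t) (λ s → B t s * C s j)) ⟨
    ∑[ t < _ ] (A i t * ∑[ s < _ ] (B t s * C s j)) ∎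

  *ᴹ-identityˡ : ∀ {m n} (A : Matrix m n) → 1ᴹ *ᴹ A ≈ᴹ A
  *ᴹ-identityˡ A i j =
    trans (diagonal-*ᴹ 1ᴹ-isDiagonal A i j) (trans (*-congʳ (1ᴹ-diagonal i)) (*-identityˡ _))

  *ᴹ-identityʳ : ∀ {m n} (A : Matrix m n) → A *ᴹ 1ᴹ ≈ᴹ A
  *ᴹ-identityʳ A i j =
    trans (*ᴹ-diagonal 1ᴹ-isDiagonal A i j) (trans (*-congˡ (1ᴹ-diagonal j)) (*-identityʳ _))

  ·-assoc : ∀ {l m n} (A : Matrix l m) (B : Matrix m n) v → (A *ᴹ B) · v ≋ A · (B · v)
  -- The vector is read as a one-column matrix.
  ·-assoc A B v i = *ᴹ-assoc A B (λ k (_ : Fin 1) → v k) i zero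

  ·-∙ : ∀ {m n} (A : Matrix m n) x v → A · (x ∙ v) ≋ x ∙ (A · v)
  ·-∙ A x v i = begin
    ∑[ k < _ ] (A i k * (x * v k))
      ≈⟨ sum-cong-≋ (λ k → solve 3 (λ p q r → p :* (q :* r) := q :* (p :* r)) refl (A i k) x (v k)) ⟩
    ∑[ k < _ ] (x * (A i k * v k))  ≈⟨ *-distribˡ-sum x (λ k → A i k * v k) ⟨
    x * ∑[ k < _ ] (A i k * v k)    ∎

  ·-∑ⱽ : ∀ {l m n} (A : Matrix m n) (f : Fin l → Vector Carrier n) →
         A · ∑ⱽ f ≋ ∑ⱽ (λ q → A · f q)
  ·-∑ⱽ A f i = begin
    ∑[ k < _ ] (A i k * ∑[ q < _ ] f q k)    ≈⟨ sum-cong-≋ (λ k → *-distribˡ-sum (A i k) (λ q → f q k)) ⟩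
    ∑[ k < _ ] ∑[ q < _ ] (A i k * f q k)    ≈⟨ ∑-comm (λ k q → A i k * f q k) ⟩
    ∑[ q < _ ] ∑[ k < _ ] (A i k * f q k)    ∎

  ⊙-*ᴹ : ∀ {l m n} (d : Vector Carrier l) (A : Matrix l m) (B : Matrix m n) →
         (d ⊙ A) *ᴹ B ≈ᴹ d ⊙ (A *ᴹ B)
  ⊙-*ᴹ d A B i j = trans
    (sum-cong-≋ λ k → *-assoc (d i) (A i k) (B k j))
    (sym (*-distribˡ-sum (d i) (λ k → A i k * B k j)))

  -- The hypothesis says entrywise that `A` intertwines `diag(e)` and `diag(d)`. It is applied to
  -- constant scalars and to matrices that commute with a 0-1 diagonal.
  *ᴹ-⊙ : ∀ {l m n} {d : Vector Carrier l} {e : Vector Carrier m} {A : Matrix l m} →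
         (∀ i j → A i j * e j ≈ d i * A i j) → (B : Matrix m n) →
         A *ᴹ (e ⊙ B) ≈ᴹ d ⊙ (A *ᴹ B)
  *ᴹ-⊙ {d = d} {e} {A} h B i j = begin
    ∑[ k < _ ] (A i k * (e k * B k j))
      ≈⟨ sum-cong-≋ (λ k → trans (sym (*-assoc _ _ _)) (trans (*-congʳ (h i k)) (*-assoc _ _ _))) ⟩
    ∑[ k < _ ] (d i * (A i k * B k j))  ≈⟨ *-distribˡ-sum (d i) (λ k → A i k * B k j) ⟨
    d i * ∑[ k < _ ] (A i k * B k j)    ∎

  -- Spectral resolutions

  -- The `E j` model the projections onto the eigenspaces of `Z`. Classically these are polynomials
  -- in `Z`; the field `commutes` records the consequence of this on which the simultaneous
  -- splitting rests.
  record SpectralResolution {n} (Z : Matrix n n) : Set (c ⊔ ℓ) where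
    field
      {size}   : ℕ
      E        : Fin size → Matrix n n
      μ        : Vector Carrier size
      complete : ∀ v → v ≋ ∑ⱽ (λ j → E j · v)
      eigen    : ∀ j → Z *ᴹ E j ≈ᴹ (λ _ → μ j) ⊙ E j
      commutes : ∀ B → B *ᴹ Z ≈ᴹ Z *ᴹ B → ∀ j → B *ᴹ E j ≈ᴹ E j *ᴹ B

  -- Groups the indices of a repeated eigenvalue. A matrix commuting with `Z` preserves whole
  -- eigenspaces but not the single lines of an eigenbasis, so each projection must cover a full
  -- class of equal values.
  representatives : ∀ {n} (d : Vector Carrier n) → (∀ i j → Dec (d i ≈ d j)) →
    Σ[ rep ∈ (Fin n → Fin n) ]
      (∀ i → d i ≈ d (rep i)) × (∀ i j → d i ≈ d j → rep i ≡ rep j)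
  representatives {zero} d _≟_ = (λ ()) , (λ ()) , λ ()
  representatives {suc n} d _≟_ with representatives (d ∘ suc) (λ i j → suc i ≟ suc j)
  ... | rep , sound , unique = rep′ , sound′ , unique′
    where
    rep′ : Fin (suc n) → Fin (suc n)
    rep′ zero = zero
    rep′ (suc i) with suc i ≟ zero
    ... | yes _ = zero
    ... | no  _ = suc (rep i)

    sound′ : ∀ i → d i ≈ d (rep′ i)
    sound′ zero = refl
    sound′ (suc i) with suc i ≟ zero
    ... | yes e = e
    ... | no  _ = sound i

    unique′ : ∀ i j → d i ≈ d j → rep′ i ≡ rep′ j
    unique′ zero zero _ = ≡.refl
    unique′ zero (suc j) e with suc j ≟ zero
    ... | yes _ = ≡.refl
    ... | no ¬e = contradiction (sym e) ¬e
    unique′ (suc i) zero e with suc i ≟ zero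
    ... | yes _ = ≡.refl
    ... | no ¬e = contradiction e ¬e
    unique′ (suc i) (suc j) e with suc i ≟ zero | suc j ≟ zero
    ... | yes _ | yes _ = ≡.refl
    ... | yes p | no ¬q = contradiction (trans (sym e) p) ¬q
    ... | no ¬p | yes q = contradiction (trans e q) ¬p
    ... | no  _ | no  _ = ≡.cong suc (unique i j e)

  -- The equation amounts to `(x - y) * z ≈ 0#`, and `x - y` is invertible.
  *-cancel-≉ : ∀ {x y z} → ¬ x ≈ y → z * y ≈ x * z → z ≈ 0#
  *-cancel-≉ {x} {y} {z} x≉y e with inverse (x - y) (x≉y ∘ x∙y⁻¹≈ε⇒x≈y x y)
  ... | t , inv = begin
    z                  ≈⟨ *-identityˡ z ⟨
    1# * z             ≈⟨ *-congʳ inv ⟨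
    (x - y) * t * z    ≈⟨ solve 3 (λ p q r → p :* q :* r := q :* (p :* r)) refl (x - y) t z ⟩
    t * ((x - y) * z)  ≈⟨ *-congˡ ([y-z]x≈yx-zx z x y) ⟩
    t * (x * z - y * z)  ≈⟨ *-congˡ (x≈y⇒x∙y⁻¹≈ε (trans (sym e) (*-comm z y))) ⟩
    t * 0#             ≈⟨ zeroʳ t ⟩
    0#                 ∎

  spectralResolution : ∀ {n} {Z : Matrix n n} (diag : Diagonalizable Z) →
    (∀ i j → Dec (Diagonalizable.D diag i i ≈ Diagonalizable.D diag j j)) →
    SpectralResolution Z
  spectralResolution {n} {Z} diag _≟_ = record
    { E = E ; μ = d ; complete = complete ; eigen = eigen ; commutes = commutes }
    where
    open Diagonalizable diag
    d = λ i → D i i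
    rep    = proj₁ (representatives d _≟_)
    sound  = proj₁ (proj₂ (representatives d _≟_))
    unique = proj₂ (proj₂ (representatives d _≟_))

    -- The indicator of the class represented by `j`. Hence `E j` projects onto the eigenspace of
    -- `d j` if `j` represents a class, and is zero otherwise.
    mask : Fin n → Vector Carrier n
    mask j k = 1ᴹ (rep k) j

    E : Fin n → Matrix n n
    E j = P *ᴹ (mask j ⊙ P⁻¹)

    ZP≈PD : Z *ᴹ P ≈ᴹ P *ᴹ D
    ZP≈PD = *ᴹ-congʳ P Z≈PDP⁻¹ ⨾ *ᴹ-assoc (P *ᴹ D) P⁻¹ P
          ⨾ *ᴹ-congˡ (P *ᴹ D) inverseˡ ⨾ *ᴹ-identityʳ (P *ᴹ D)

    P⁻¹Z≈DP⁻¹ : P⁻¹ *ᴹ Z ≈ᴹ D *ᴹ P⁻¹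
    P⁻¹Z≈DP⁻¹ = *ᴹ-congˡ P⁻¹ (Z≈PDP⁻¹ ⨾ *ᴹ-assoc P D P⁻¹)
              ⨾ ≈ᴹ-sym (*ᴹ-assoc P⁻¹ P (D *ᴹ P⁻¹))
              ⨾ *ᴹ-congʳ (D *ᴹ P⁻¹) inverseˡ ⨾ *ᴹ-identityˡ (D *ᴹ P⁻¹)

    ∑E≈1 : ∀ i k → ∑[ j < n ] E j i k ≈ 1ᴹ i k
    ∑E≈1 i k = begin
      ∑[ j < n ] ∑[ l < n ] (P i l * (mask j l * P⁻¹ l k))
        ≈⟨ ∑-comm (λ j l → P i l * (mask j l * P⁻¹ l k)) ⟩
      ∑[ l < n ] ∑[ j < n ] (P i l * (mask j l * P⁻¹ l k))
        -- Each `l` lies in exactly one class, so only the term `j = rep l` survives.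
        ≈⟨ sum-cong-≋ (λ l → sum-single _ (rep l) λ j j≢ →
             trans (*-congˡ (trans (*-congʳ (1ᴹ-isDiagonal _ _ (j≢ ∘ ≡.sym))) (zeroˡ _))) (zeroʳ _)) ⟩
      ∑[ l < n ] (P i l * (mask (rep l) l * P⁻¹ l k))
        ≈⟨ sum-cong-≋ (λ l → *-congˡ {P i l}
             (trans (*-congʳ (1ᴹ-diagonal (rep l))) (*-identityˡ (P⁻¹ l k)))) ⟩
      ∑[ l < n ] (P i l * P⁻¹ l k)
        ≈⟨ inverseʳ i k ⟩
      1ᴹ i k ∎

    complete : ∀ v → v ≋ ∑ⱽ (λ j → E j · v)
    complete v i = sym (begin
      ∑[ j < n ] ∑[ k < n ] (E j i k * v k)    ≈⟨ ∑-comm (λ j k → E j i k * v k) ⟩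
      ∑[ k < n ] ∑[ j < n ] (E j i k * v k)
        ≈⟨ sum-cong-≋ (λ k → trans (sym (*-distribʳ-sum (v k) (λ j → E j i k))) (*-congʳ (∑E≈1 i k))) ⟩
      ∑[ k < n ] (1ᴹ i k * v k)                ≈⟨ *ᴹ-identityˡ (λ k (_ : Fin 1) → v k) i zero ⟩
      v i                                      ∎)

    d-mask : ∀ j k → d k * mask j k ≈ d j * mask j k
    d-mask j k with rep k Fin.≟ j
    ... | yes ≡.refl = *-congʳ (sound k)
    ... | no  _      = trans (zeroʳ _) (sym (zeroʳ _))

    eigen : ∀ j → Z *ᴹ E j ≈ᴹ (λ _ → d j) ⊙ E j
    eigen j = ≈ᴹ-sym (*ᴹ-assoc Z P _) ⨾ *ᴹ-congʳ _ ZP≈PD ⨾ *ᴹ-assoc P D _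
            ⨾ *ᴹ-congˡ P (diagonal-*ᴹ diagonal _ ⨾ λ k l →
                trans (sym (*-assoc _ _ _)) (trans (*-congʳ (d-mask j k)) (*-assoc _ _ _)))
            ⨾ *ᴹ-⊙ (λ i k → *-comm _ _) (mask j ⊙ P⁻¹)

    commutes : ∀ B → B *ᴹ Z ≈ᴹ Z *ᴹ B → ∀ j → B *ᴹ E j ≈ᴹ E j *ᴹ B
    commutes B BZ≈ZB j =
        ≈ᴹ-sym (*ᴹ-assoc B P _) ⨾ *ᴹ-congʳ _ BP≈PB′ ⨾ *ᴹ-assoc P B′ _
      ⨾ *ᴹ-congˡ P (*ᴹ-⊙ B′-mask P⁻¹
          ⨾ (λ k l → *-congˡ (B′P⁻¹≈P⁻¹B k l))
          ⨾ ≈ᴹ-sym (⊙-*ᴹ (mask j) P⁻¹ B))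
      ⨾ ≈ᴹ-sym (*ᴹ-assoc P _ B)
      where
      -- `B` in the eigenbasis. It commutes with `D`, so its entries between different eigenvalues
      -- vanish, while a mask is constant on indices of equal eigenvalue; therefore `B′` commutes
      -- with every mask.
      B′ : Matrix n n
      B′ = P⁻¹ *ᴹ (B *ᴹ P)

      BP≈PB′ : B *ᴹ P ≈ᴹ P *ᴹ B′
      BP≈PB′ = ≈ᴹ-sym (*ᴹ-identityˡ _) ⨾ *ᴹ-congʳ _ (≈ᴹ-sym inverseʳ) ⨾ *ᴹ-assoc P P⁻¹ _

      B′P⁻¹≈P⁻¹B : B′ *ᴹ P⁻¹ ≈ᴹ P⁻¹ *ᴹ B
      B′P⁻¹≈P⁻¹B = *ᴹ-assoc P⁻¹ _ P⁻¹
        ⨾ *ᴹ-congˡ P⁻¹ (*ᴹ-assoc B P P⁻¹ ⨾ *ᴹ-congˡ B inverseʳ ⨾ *ᴹ-identityʳ B)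

      B′D≈DB′ : B′ *ᴹ D ≈ᴹ D *ᴹ B′
      B′D≈DB′ = *ᴹ-assoc P⁻¹ _ D
        ⨾ *ᴹ-congˡ P⁻¹ (*ᴹ-assoc B P D ⨾ *ᴹ-congˡ B (≈ᴹ-sym ZP≈PD)
            ⨾ ≈ᴹ-sym (*ᴹ-assoc B Z P) ⨾ *ᴹ-congʳ P BZ≈ZB ⨾ *ᴹ-assoc Z B P)
        ⨾ ≈ᴹ-sym (*ᴹ-assoc P⁻¹ Z _) ⨾ *ᴹ-congʳ _ P⁻¹Z≈DP⁻¹ ⨾ *ᴹ-assoc D P⁻¹ _

      B′-mask : ∀ i k → B′ i k * mask j k ≈ mask j i * B′ i k
      B′-mask i k with i ≟ k
      ... | yes e rewrite unique i k e = *-comm _ _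
      ... | no ¬e = begin
        B′ i k * mask j k  ≈⟨ *-congʳ B′≈0 ⟩
        0# * mask j k      ≈⟨ zeroˡ _ ⟩
        0#                 ≈⟨ zeroʳ _ ⟨
        mask j i * 0#      ≈⟨ *-congˡ B′≈0 ⟨
        mask j i * B′ i k  ∎
        where
        B′≈0 : B′ i k ≈ 0#
        B′≈0 = *-cancel-≉ ¬e (trans (sym (*ᴹ-diagonal diagonal B′ i k))
          (trans (B′D≈DB′ i k) (diagonal-*ᴹ diagonal B′ i k)))

  -- Only finitely many comparisons of eigenvalues have to be decided.
  ¬¬-spectralResolution : ∀ {n} {Z : Matrix n n} → Diagonalizable Z → ¬ ¬ SpectralResolution Z
  ¬¬-spectralResolution diag =
    ¬¬-map (spectralResolution diag) (¬¬-∀ λ i → ¬¬-∀ λ j → ¬¬-excluded-middle)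

  -- Common eigenvectors

  CommonEigenvector : ∀ {n p} → (Fin p → Matrix n n) → Vector Carrier n → Set (c ⊔ ℓ)
  CommonEigenvector Z v = ∀ k → ∃[ μ ] Z k · v ≋ μ ∙ v

  -- The vector `v` is only required to equal the sum up to `≋`, because `S` is not assumed to
  -- respect `≋`.
  ∑-Closed : ∀ {n} → (Vector Carrier n → Set a) → Set (c ⊔ ℓ ⊔ a)
  ∑-Closed {n = n} S = ∀ {m} (f : Fin m → Vector Carrier n) → (∀ j → S (f j)) →
                       ∀ {v} → v ≋ ∑ⱽ f → S v

  -- `E j` commutes with `B`, so splitting along `Z` keeps the eigenvector conditions already
  -- secured for `B`.
  eigen-projection : ∀ {n} {B Z : Matrix n n} → B *ᴹ Z ≈ᴹ Z *ᴹ B →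
    (ζ : SpectralResolution Z) → ∀ j {κ v} → B · v ≋ κ ∙ v →
    let open SpectralResolution ζ in B · (E j · v) ≋ κ ∙ (E j · v)
  eigen-projection {B = B} BZ≈ZB ζ j {κ} {v} Bv≋κv i = begin
    (B · (E j · v)) i   ≈⟨ ·-assoc B (E j) v i ⟨
    ((B *ᴹ E j) · v) i  ≈⟨ sum-cong-≋ (λ k → *-congʳ (commutes B BZ≈ZB j i k)) ⟩
    ((E j *ᴹ B) · v) i  ≈⟨ ·-assoc (E j) B v i ⟩
    (E j · (B · v)) i   ≈⟨ sum-cong-≋ (λ k → *-congˡ (Bv≋κv k)) ⟩
    (E j · (κ ∙ v)) i   ≈⟨ ·-∙ (E j) κ v i ⟩
    (κ ∙ (E j · v)) i   ∎
    where open SpectralResolution ζ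

  -- Induction on the number of matrices; for none of them every vector qualifies. Spanning is
  -- expressed through all sum-closed predicates `S`, so that `S` can later be a doubly negated
  -- span.
  commonEigenvectors-span : ∀ {n p} (Z : Fin p → Matrix n n) → PairwiseCommuting Z →
    (∀ k → SpectralResolution (Z k)) →
    {S : Vector Carrier n → Set a} → ∑-Closed S →
    (∀ {v} → CommonEigenvector Z v → S v) → ∀ v → S v
  commonEigenvectors-span {p = zero}  Z comm ζ closed incl v = incl λ ()
  commonEigenvectors-span {p = suc p} Z comm ζ closed incl =
    commonEigenvectors-span (Z ∘ suc) (λ k l → comm (suc k) (suc l)) (ζ ∘ suc) closed
      -- A common eigenvector of the remaining matrices is the sum of its projections for `Z zero`,
      -- each of which is an eigenvector of all matrices. Projections may vanish, so
      -- `CommonEigenvector` admits the zero vector.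
      λ {v} eig → closed (λ j → E j · v) (λ j → incl λ
        { zero → μ j , λ i → trans (sym (·-assoc (Z zero) (E j) v i))
            (trans (sum-cong-≋ λ k → trans (*-congʳ (eigen j i k)) (*-assoc _ _ _))
              (sym (*-distribˡ-sum (μ j) (λ k → E j i k * v k))))
        ; (suc k) → proj₁ (eig k) ,
            eigen-projection (comm (suc k) zero) (ζ zero) j (proj₂ (eig k))
        }) (complete v)
    where open SpectralResolution (ζ zero)

  -- Spanning subfamilies

  InSpan : ∀ {n k} → (Fin k → Vector Carrier n) → Vector Carrier n → Set (c ⊔ ℓ)
  InSpan {k = k} x v = Σ[ w ∈ Vector Carrier k ] v ≋ ∑ⱽ (λ q → w q ∙ x q)

  InSpan-closed : ∀ {n k} (x : Fin k → Vector Carrier n) → ∑-Closed (λ v → ¬ ¬ InSpan x v)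
  InSpan-closed x f spans {v} v≋∑f = do
    s ← ¬¬-∀ spans
    return (∑ⱽ (proj₁ ∘ s) , λ i → begin
      v i                                                ≈⟨ v≋∑f i ⟩
      ∑[ j < _ ] f j i                                   ≈⟨ sum-cong-≋ (λ j → proj₂ (s j) i) ⟩
      ∑[ j < _ ] ∑[ q < _ ] (proj₁ (s j) q * x q i)
        ≈⟨ ∑-comm (λ j q → proj₁ (s j) q * x q i) ⟩
      ∑[ q < _ ] ∑[ j < _ ] (proj₁ (s j) q * x q i)
        ≈⟨ sum-cong-≋ (λ q → *-distribʳ-sum (x q i) (λ j → proj₁ (s j) q)) ⟨
      ∑[ q < _ ] (∑[ j < _ ] proj₁ (s j) q * x q i)      ∎)

  -- A member of the family with nonzero first entry, if there is one, clears
  -- the first entries of all others by elimination.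
  spanning-subfamily : ∀ n {I : Set a} (x : I → Vector Carrier n) →
    ¬ ¬ (∃[ k ] k ≤ n × Σ[ σ ∈ (Fin k → I) ] (∀ v → ¬ ¬ InSpan (x ∘ σ) (x v)))
  spanning-subfamily zero x = return (0 , z≤n , (λ ()) , λ v → return ((λ ()) , λ ()))
  spanning-subfamily (suc n) {I} x = ¬¬-excluded-middle >>= λ
    { (no none) → do
        k , k≤n , σ , spans ← spanning-subfamily n (λ v → x v ∘ suc)
        return (k , ℕ.m≤n⇒m≤1+n k≤n , σ , λ v → do
          w , e ← spans v
          -- `none` refutes only that the entry is nonzero, which gives its vanishing up to double
          -- negation. As `I` may be infinite, this is done separately for each `v`.
          x≈0  ← λ x≉0 → none (v , x≉0)
          y≈0  ← ¬¬-∀ λ q y≉0 → none (σ q , y≉0)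
          return (w , λ
            { zero → trans x≈0 (sym (sum-zero _ λ q → trans (*-congˡ (y≈0 q)) (zeroʳ _)))
            ; (suc i) → e i }))
    ; (yes (t , xt≉0)) → eliminate t xt≉0
    }
    where
    eliminate : ∀ t → ¬ x t zero ≈ 0# →
      ¬ ¬ (∃[ k ] k ≤ suc n × Σ[ σ ∈ (Fin k → I) ] (∀ v → ¬ ¬ InSpan (x ∘ σ) (x v)))
    eliminate t xt≉0 = do
      k , k≤n , σ , spans ← spanning-subfamily n (λ v → y v ∘ suc)
      return (suc k , s≤s k≤n , (λ { zero → t ; (suc q) → σ q }) , λ v → do
        w , e ← spans v
        -- Substituting `y = x - m x_t` into `y v = Σ w_q y_(σ q)` gives `x_t` the coefficient
        -- `m v - Σ w_q m_(σ q)`. The relation from `spans` covers the later entries; at the first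
        -- entry both sides vanish.
        return ((λ { zero → m v + ∑[ q < k ] (w q * - m (σ q)) ; (suc q) → w q })
               , combine σ v w (λ
                 { zero → trans (y₀≈0 v) (sym (sum-zero _ λ q → trans (*-congˡ (y₀≈0 (σ q))) (zeroʳ _)))
                 ; (suc i) → e i })))
      where
      x₀⁻¹ = proj₁ (inverse (x t zero) xt≉0)

      m : I → Carrier
      m v = x v zero * x₀⁻¹

      y : I → Vector Carrier (suc n)
      y v i = x v i + - m v * x t i

      x≈y+ : ∀ v i → x v i ≈ y v i + m v * x t i
      x≈y+ v i = sym (begin
        x v i + - m v * x t i + m v * x t i      ≈⟨ +-assoc _ _ _ ⟩
        x v i + (- m v * x t i + m v * x t i)    ≈⟨ +-congˡ (+-congʳ (-‿distribˡ-* (m v) (x t i))) ⟨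
        x v i + (- (m v * x t i) + m v * x t i)  ≈⟨ +-congˡ (-‿inverseˡ _) ⟩
        x v i + 0#                               ≈⟨ +-identityʳ _ ⟩
        x v i                                    ∎)

      y₀≈0 : ∀ v → y v zero ≈ 0#
      y₀≈0 v = begin
        x v zero + - m v * x t zero    ≈⟨ +-congˡ (-‿distribˡ-* (m v) (x t zero)) ⟨
        x v zero - m v * x t zero      ≈⟨ x≈y⇒x∙y⁻¹≈ε (sym (begin
          x v zero * x₀⁻¹ * x t zero    ≈⟨ *-assoc _ _ _ ⟩
          x v zero * (x₀⁻¹ * x t zero)
            ≈⟨ *-congˡ (trans (*-comm _ _) (proj₂ (inverse (x t zero) xt≉0))) ⟩
          x v zero * 1#                 ≈⟨ *-identityʳ _ ⟩
          x v zero                      ∎)) ⟩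
        0#                             ∎

      combine : ∀ {k} (σ : Fin k → I) v w → y v ≋ ∑ⱽ (λ q → w q ∙ y (σ q)) → ∀ i →
        x v i ≈ (m v + ∑[ q < k ] (w q * - m (σ q))) * x t i + ∑[ q < k ] (w q * x (σ q) i)
      combine {k} σ v w e i = begin
        x v i                      ≈⟨ x≈y+ v i ⟩
        y v i + m v * x t i        ≈⟨ +-congʳ (e i) ⟩
        ∑[ q < k ] (w q * (x (σ q) i + - m (σ q) * x t i)) + m v * x t i
          ≈⟨ +-congʳ (trans
               (sum-cong-≋ λ q → solve 4 (λ w x m z → w :* (x :+ m :* z) := w :* x :+ w :* m :* z)
                 refl (w q) (x (σ q) i) (- m (σ q)) (x t i))
               (trans (∑-distrib-+ (λ q → w q * x (σ q) i) (λ q → w q * - m (σ q) * x t i))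
                 (+-congˡ (sym (*-distribʳ-sum (x t i) (λ q → w q * - m (σ q))))))) ⟩
        ∑wx + ∑wm * x t i + m v * x t i
          ≈⟨ solve 4 (λ s r z m → s :+ r :* z :+ m :* z := (m :+ r) :* z :+ s)
               refl ∑wx ∑wm (x t i) (m v) ⟩
        (m v + ∑wm) * x t i + ∑wx  ∎
        where
        ∑wx = ∑[ q < k ] (w q * x (σ q) i)
        ∑wm = ∑[ q < k ] (w q * - m (σ q))

  -- Tensor rank

  IsSumOfRankOnes-resp : ∀ {m n p r} {S T : Tensor m n p} → S ≈ᵀ T →
                         IsSumOfRankOnes T r → IsSumOfRankOnes S r
  IsSumOfRankOnes-resp S≈T (t , one , e) = t , one , λ i j k → trans (S≈T i j k) (e i j k)

  IsSumOfRankOnes-cons : ∀ {m n p r} {S T : Tensor m n p} → IsRankOne S →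
    IsSumOfRankOnes T r → IsSumOfRankOnes (λ i j k → S i j k + T i j k) (suc r)
  IsSumOfRankOnes-cons {S = S} one (t , ones , e) =
      (λ { zero → S ; (suc s) → t s })
    , (λ { zero → one ; (suc s) → ones s })
    , λ i j k → +-congˡ (e i j k)

  ⊗-isRankOne : ∀ {m n p} (u : Vector Carrier m) (v : Vector Carrier n) (w : Vector Carrier p) →
    ¬ (∀ i j k → (u ⊗ v ⊗ w) i j k ≈ 0#) → IsRankOne (u ⊗ v ⊗ w)
  ⊗-isRankOne u v w ≉0 = u , v , w
    , (λ u≈0 → ≉0 λ i j k → trans (*-congʳ (trans (*-congʳ (u≈0 i)) (zeroˡ _))) (zeroˡ _))
    , (λ v≈0 → ≉0 λ i j k → trans (*-congʳ (trans (*-congˡ (v≈0 j)) (zeroʳ _))) (zeroˡ _))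
    , (λ w≈0 → ≉0 λ i j k → trans (*-congˡ (w≈0 k)) (zeroʳ _))
    , λ i j k → refl

  -- Vanishing terms are dropped, so the count may fall below `r`. Deciding which terms vanish takes
  -- excluded middle, hence the double negation.
  ∑-⊗-isSumOfRankOnes : ∀ {m n p} r (u : Fin r → Vector Carrier m)
    (v : Fin r → Vector Carrier n) (w : Fin r → Vector Carrier p) →
    ¬ ¬ (∃[ s ] s ≤ r × IsSumOfRankOnes (∑ᵀ λ q → u q ⊗ v q ⊗ w q) s)
  ∑-⊗-isSumOfRankOnes zero u v w =
    return (0 , z≤n , (λ ()) , (λ ()) , λ i j k → refl)
  ∑-⊗-isSumOfRankOnes (suc r) u v w = do
    s , s≤r , sum ← ∑-⊗-isSumOfRankOnes r (u ∘ suc) (v ∘ suc) (w ∘ suc)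
    (no ≉0) ← ¬¬-excluded-middle
      where (yes ≈0) → return (s , ℕ.m≤n⇒m≤1+n s≤r , IsSumOfRankOnes-resp
              (λ i j k → trans (+-congʳ (≈0 i j k)) (+-identityˡ _)) sum)
    return (suc s , s≤s s≤r ,
      IsSumOfRankOnes-cons (⊗-isRankOne (u zero) (v zero) (w zero) ≉0) sum)

  -- The row `1ᴹ j` of the identity serves as the standard basis vector.
  ·-1ᴹ : ∀ {m n} (A : Matrix m n) j → A · 1ᴹ j ≋ (λ i → A i j)
  ·-1ᴹ A j i = trans
    (sum-single _ j λ k k≢j → trans (*-congˡ (1ᴹ-isDiagonal j k (k≢j ∘ ≡.sym))) (zeroʳ _))
    (trans (*-congˡ (1ᴹ-diagonal j)) (*-identityʳ _))

  -- Tensor decomposition from common eigenvectors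

  commuting-diagonalizable-rank : ∀ {n p N} (A : Fin p → Matrix n n) (Z : Fin p → Matrix N N) →
    PairwiseCommuting Z → (∀ k → Diagonalizable (Z k)) →
    (n≤N : n ≤ N) → (∀ k → IsTopLeftOf n≤N (A k) (Z k)) →
    ¬ ¬ (∃[ s ] s ≤ N × IsSumOfRankOnes (fromSlices A) s)
  commuting-diagonalizable-rank {n} {p} {N} A Z comm diag n≤N top = do
    ζ ← ¬¬-∀ (¬¬-spectralResolution ∘ diag)
    -- The family of all common eigenvectors is indexed by vectors paired with their eigenvalues, so
    -- `σ` delivers both.
    M , M≤N , σ , spans ← spanning-subfamily N {Σ[ v ∈ _ ] CommonEigenvector Z v} proj₁
    -- Here `S` is the doubly negated span of the chosen vectors.
    y ← ¬¬-∀ λ (j : Fin N) → commonEigenvectors-span Z comm ζ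
          (InSpan-closed (proj₁ ∘ σ)) (λ eig → spans (_ , eig)) (1ᴹ j)
    s , s≤M , sum ← ∑-⊗-isSumOfRankOnes M (u σ) (v σ y) (w σ)
    return (s , ℕ.≤-trans s≤M M≤N , IsSumOfRankOnes-resp (decompose σ y) sum)
    where
    -- `σ` and `y` exist only inside the double negation, so the factors take them as parameters.
    -- The third factor `w q` lists the eigenvalues of the `q`-th vector.
    module _ {M} (σ : Fin M → Σ[ b ∈ Vector Carrier N ] CommonEigenvector Z b) where
      ι : Fin n → Fin N
      ι i = inject≤ i n≤N

      u : Fin M → Vector Carrier n
      u q i = proj₁ (σ q) (ι i)

      w : Fin M → Vector Carrier p
      w q k = proj₁ (proj₂ (σ q) k)

      module _ (y : ∀ j → InSpan (proj₁ ∘ σ) (1ᴹ j)) where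
        v : Fin M → Vector Carrier n
        v q j = proj₁ (y (ι j)) q

        decompose : fromSlices A ≈ᵀ ∑ᵀ (λ q → u q ⊗ v q ⊗ w q)
        decompose i j k = begin
          A k i j                      ≈⟨ top k i j ⟨
          Z k (ι i) (ι j)              ≈⟨ ·-1ᴹ (Z k) (ι j) (ι i) ⟨
          (Z k · 1ᴹ (ι j)) (ι i)       ≈⟨ sum-cong-≋ (λ l → *-congˡ (proj₂ (y (ι j)) l)) ⟩
          (Z k · ∑ⱽ (λ q → v q j ∙ proj₁ (σ q))) (ι i)
            ≈⟨ ·-∑ⱽ (Z k) (λ q → v q j ∙ proj₁ (σ q)) (ι i) ⟩
          ∑[ q < M ] (Z k · (v q j ∙ proj₁ (σ q))) (ι i)
            ≈⟨ sum-cong-≋ (λ q → trans (·-∙ (Z k) (v q j) (proj₁ (σ q)) (ι i)) (trans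
                 (*-congˡ (proj₂ (proj₂ (σ q) k) (ι i)))
                 (solve 3 (λ v w u → v :* (w :* u) := u :* v :* w) refl
                   (v q j) (w q k) (u q i)))) ⟩
          ∑[ q < M ] (u q i * v q j * w q k) ∎

-- The rank bound over subfields of ℂ

theorem34 : ∀ {ℓ} (K : Subfield ℂ-commutativeRing ℓ) →
    let open LinearAlgebra (Subfield.commutativeRing K) in
    ∀ (n p : ℕ) (A : Fin p → Matrix n n) →
    ∀ (N : ℕ) (Z : Fin p → Matrix N N) →
    PairwiseCommuting Z →
    (∀ k → Diagonalizable (Z k)) →
    (n≤N : n ≤ N) → (∀ k → IsTopLeftOf n≤N (A k) (Z k)) →
    ∀ r → HasRank (fromSlices A) r →
    N ≥ r
theorem34 K n p A N Z comm diag n≤N top r (_ , minimal) =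
  decidable-stable (r ℕ.≤? N) (¬¬-map
    (λ (s , s≤N , sum) → ℕ.≤-trans (minimal s sum) s≤N)
    (commuting-diagonalizable-rank A Z comm diag n≤N top))
  where
  open FieldAlgebra (Subfield.commutativeRing K) (subfield-hasInverses K)
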